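{- Let $A\in\mathcal{V}$ and let $\theta$ be a congruence of $A$ with $\theta\subseteq Rad(A)$. Let $\Omega'$ be an orthogonal subset of $B(Con(A/\theta))$ which is lifted by $p_\theta$ to a subset $\Omega$ of $B(Con(A))$. Then $\Omega$ is the unique subset of $B(Con(A))$ to which $p_\theta$ lifts $\Omega'$, and $\Omega$ is orthogonal.
   Context: $\mathcal{V}$ is a congruence modular, semidegenerate variety (no nontrivial algebra has a one-element subalgebra) of finite signature, such that for every $B\in\mathcal{V}$ the set $K(B)$ of compact congruences is closed under the Freese–McKenzie commutator $[\cdot,\cdot]$. $Con(A)$ is the congruence lattice with bounds $\Delta_A,\nabla_A$; $Rad(A)$ is the intersection of all maximal congruences of $A$; $B(Con(A))$ is the Boolean algebra of complemented elements of $Con(A)$. $p_\theta:A\to A/\theta$ is the canonical surjection, and $p_\theta^{\bullet}(\alpha)=(\alpha\vee\theta)/\theta$ for $\alpha\in Con(A)$; it restricts to a Boolean morphism $B(Con(A))\to B(Con(A/\theta))$. $p_\theta$ lifts $\Omega'\subseteq Con(A/\theta)$ to $\Omega\subseteq Con(A)$ if $\Omega'=\{p_\theta^{\bullet}(\alpha):\alpha\in\Omega\}$. A subset of a Boolean algebra of congruences is orthogonal if any two distinct elements meet (equivalently, have commutator) equal to the least congruence. -}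

module Defs where

open import Level using (Level; _⊔_; suc; Lift; lift)
open import Data.Nat.Base using (ℕ)
open import Data.Fin.Base using (Fin)
open import Data.List.Base using (List)
open import Data.List.Membership.Propositional using () renaming (_∈_ to _∈ₗ_)
open import Data.List.Relation.Unary.All using (All)
open import Data.Product.Base using (Σ; ∃; _×_; _,_; proj₁; proj₂)
open import Data.Sum.Base using (_⊎_; inj₁; inj₂; [_,_]′)
open import Data.Unit.Base using (⊤; tt)
open import Data.Vec.Functional using (Vector)
open import Function.Base using (_∘_)
open import Function.Bundles using (_⇔_)
open import Relation.Binary.Bundles using (Setoid; Poset)
open import Relation.Binary.Core using (Rel; _⇒_)
open import Relation.Binary.Definitions using (_Respects_)
open import Relation.Binary.Lattice.Bundles using (Lattice; BoundedLattice)
open import Relation.Binary.Structures using (IsEquivalence)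
open import Relation.Nullary.Negation using (¬_)
open import Relation.Unary using (Pred; _∈_)

private
  variable
    c ℓ ℓ₁ ℓ₂ p q r s v : Level

-- The choice principle of the classical metatheory (cf. Axiom.ExcludedMiddle).

module _ (P : Poset c ℓ₁ ℓ₂) where
  open Poset P

  IsChain : Pred Carrier p → Set (c ⊔ ℓ₂ ⊔ p)
  IsChain C = ∀ {x y} → x ∈ C → y ∈ C → x ≤ y ⊎ y ≤ x

  UpperBound : Pred Carrier p → Pred Carrier (c ⊔ ℓ₂ ⊔ p)
  UpperBound C u = ∀ {x} → x ∈ C → x ≤ u

  MaximalElement : Pred Carrier (c ⊔ ℓ₁ ⊔ ℓ₂)
  MaximalElement m = ∀ {x} → m ≤ x → x ≈ m

ZornsLemma : ∀ c ℓ₁ ℓ₂ → Set (suc (c ⊔ ℓ₁ ⊔ ℓ₂))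
ZornsLemma c ℓ₁ ℓ₂ =
  (P : Poset c ℓ₁ ℓ₂) →
  ((C : Pred (Poset.Carrier P) c) → IsChain P C → ∃ (UpperBound P C)) →
  ∃ (MaximalElement P)

module _ (L : Lattice c ℓ₁ ℓ₂) where
  open Lattice L

  Modular : Set (c ⊔ ℓ₁ ⊔ ℓ₂)
  Modular = ∀ x y z → x ≤ z → (x ∨ (y ∧ z)) ≈ ((x ∨ y) ∧ z)

module _ (L : BoundedLattice c ℓ₁ ℓ₂) where
  open BoundedLattice L renaming (⊤ to 𝟏; ⊥ to 𝟎)

  -- B(L), as a subset of L.
  Complemented : Pred Carrier (c ⊔ ℓ₁)
  Complemented x = ∃ λ y → (x ∨ y) ≈ 𝟏 × (x ∧ y) ≈ 𝟎

  Orthogonal : Pred Carrier p → Set (c ⊔ ℓ₁ ⊔ p)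
  Orthogonal Ω = ∀ {x y} → x ∈ Ω → y ∈ Ω → ¬ (x ≈ y) → (x ∧ y) ≈ 𝟎

  -- Lattice elements are compared by ≈, so subsets have to be ≈-closed.
  record Subset p : Set (c ⊔ ℓ₁ ⊔ suc p) where
    field
      member   : Pred Carrier p
      respects : member Respects _≈_

record Signature : Set where
  field
    numOps : ℕ
    arity  : Fin numOps → ℕ

  Op : Set
  Op = Fin numOps

open Signature

-- Carriers are nonempty by convention; homomorphisms and subalgebras need not
-- preserve the witness.
record Algebra (τ : Signature) (ℓ : Level) : Set (suc ℓ) where
  field
    setoid : Setoid ℓ ℓ

  open Setoid setoid public

  field
    ⟦_⟧      : (f : Op τ) → Vector Carrier (arity τ f) → Carrier
    ⟦⟧-cong  : ∀ f {xs ys : Vector Carrier (arity τ f)} →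
               (∀ i → xs i ≈ ys i) → ⟦ f ⟧ xs ≈ ⟦ f ⟧ ys
    nonempty : Carrier

data Term (τ : Signature) (X : Set) : Set where
  var : X → Term τ X
  app : (f : Op τ) → Vector (Term τ X) (arity τ f) → Term τ X

module _ {τ : Signature} where

  eval : (A : Algebra τ ℓ) {X : Set} →
         Term τ X → (X → Algebra.Carrier A) → Algebra.Carrier A
  eval A (var x)    ρ = ρ x
  eval A (app f ts) ρ = Algebra.⟦_⟧ A f (λ i → eval A (ts i) ρ)

  record Hom (A B : Algebra τ ℓ) : Set ℓ where
    private
      module A = Algebra A
      module B = Algebra B
    field
      to   : A.Carrier → B.Carrier
      cong : ∀ {x y} → x A.≈ y → to x B.≈ to y
      homo : ∀ f xs → to (A.⟦ f ⟧ xs) B.≈ B.⟦ f ⟧ (to ∘ xs)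

  IsSurjective : {A B : Algebra τ ℓ} → Hom A B → Set ℓ
  IsSurjective {A = A} {B} h = ∀ y → ∃ λ x → Algebra._≈_ B (Hom.to h x) y

  record Subalgebra (A : Algebra τ ℓ) : Set (suc ℓ) where
    open Algebra A
    field
      member    : Pred Carrier ℓ
      respects  : member Respects _≈_
      closed    : ∀ f xs → (∀ i → xs i ∈ member) → ⟦ f ⟧ xs ∈ member
      inhabited : ∃ member

  ⌞_⌟ : {A : Algebra τ ℓ} → Subalgebra A → Algebra τ ℓ
  ⌞_⌟ {A = A} S = record
    { setoid   = record
      { Carrier       = Σ Carrier member
      ; _≈_           = λ x y → proj₁ x ≈ proj₁ y
      ; isEquivalence = record { refl = refl ; sym = sym ; trans = trans }
      }
    ; ⟦_⟧      = λ f xs → ⟦ f ⟧ (proj₁ ∘ xs) , closed f (proj₁ ∘ xs) (proj₂ ∘ xs)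
    ; ⟦⟧-cong  = λ f → ⟦⟧-cong f
    ; nonempty = inhabited
    }
    where
    open Algebra A
    open Subalgebra S

  Π : {I : Set ℓ} → (I → Algebra τ ℓ) → Algebra τ ℓ
  Π {I = I} A = record
    { setoid   = record
      { Carrier       = ∀ i → A.Carrier i
      ; _≈_           = λ x y → ∀ i → A._≈_ i (x i) (y i)
      ; isEquivalence = record
        { refl  = λ i → A.refl i
        ; sym   = λ e i → A.sym i (e i)
        ; trans = λ d e i → A.trans i (d i) (e i)
        }
      }
    ; ⟦_⟧      = λ f xs i → A.⟦_⟧ i f (λ j → xs j i)
    ; ⟦⟧-cong  = λ f e i → A.⟦⟧-cong i f (λ j → e j i)
    ; nonempty = λ i → A.nonempty i
    }
    where
    module A i = Algebra (A i)

  Trivial : Pred (Algebra τ ℓ) ℓ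
  Trivial A = ∀ x y → x ≈ y
    where open Algebra A

  -- Quotients are taken by coarsening the setoid equality, so a congruence is
  -- required to contain the equality of the algebra.
  record Congruence (A : Algebra τ ℓ) (r : Level) : Set (ℓ ⊔ suc r) where
    open Algebra A
    field
      rel           : Rel Carrier r
      isEquivalence : IsEquivalence rel
      contains-≈    : _≈_ ⇒ rel
      compatible    : ∀ f {xs ys : Vector Carrier (arity τ f)} →
                      (∀ i → rel (xs i) (ys i)) → rel (⟦ f ⟧ xs) (⟦ f ⟧ ys)

  open Congruence using (rel)

  module _ {A : Algebra τ ℓ} where
    infix 4 _⊑_ _≋_

    _⊑_ : Congruence A r → Congruence A s → Set (ℓ ⊔ r ⊔ s)
    α ⊑ β = rel α ⇒ rel β

    _≋_ : Congruence A r → Congruence A s → Set (ℓ ⊔ r ⊔ s)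
    α ≋ β = α ⊑ β × β ⊑ α

  module _ (A : Algebra τ ℓ) where
    open Algebra A

    data CgRel (R : Rel Carrier r) : Rel Carrier (ℓ ⊔ r) where
      base   : ∀ {x y} → R x y → CgRel R x y
      ≈⇒     : ∀ {x y} → x ≈ y → CgRel R x y
      symm   : ∀ {x y} → CgRel R x y → CgRel R y x
      transi : ∀ {x y z} → CgRel R x y → CgRel R y z → CgRel R x z
      compat : ∀ f {xs ys : Vector Carrier (arity τ f)} →
               (∀ i → CgRel R (xs i) (ys i)) → CgRel R (⟦ f ⟧ xs) (⟦ f ⟧ ys)

    -- The congruence generated by R.
    Cg : Rel Carrier r → Congruence A (ℓ ⊔ r)
    Cg R = record
      { rel           = CgRel R
      ; isEquivalence = record { refl = ≈⇒ refl ; sym = symm ; trans = transi }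
      ; contains-≈    = ≈⇒
      ; compatible    = compat
      }

  Cg-least : {A : Algebra τ ℓ} {R : Rel (Algebra.Carrier A) r} (γ : Congruence A s) →
             R ⇒ rel γ → Cg A R ⊑ γ
  Cg-least γ R⇒γ (base Rxy)   = R⇒γ Rxy
  Cg-least γ R⇒γ (≈⇒ e)       = Congruence.contains-≈ γ e
  Cg-least γ R⇒γ (symm d)     = IsEquivalence.sym (Congruence.isEquivalence γ) (Cg-least γ R⇒γ d)
  Cg-least γ R⇒γ (transi d e) =
    IsEquivalence.trans (Congruence.isEquivalence γ) (Cg-least γ R⇒γ d) (Cg-least γ R⇒γ e)
  Cg-least γ R⇒γ (compat f e) = Congruence.compatible γ f (λ i → Cg-least γ R⇒γ (e i))

  module _ {A : Algebra τ ℓ} where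
    open Algebra A

    Δ : Congruence A ℓ
    Δ = record
      { rel           = _≈_
      ; isEquivalence = isEquivalence
      ; contains-≈    = λ e → e
      ; compatible    = ⟦⟧-cong
      }

    ∇ : Congruence A ℓ
    ∇ = record
      { rel           = λ _ _ → Lift ℓ ⊤
      ; isEquivalence = record
        { refl = lift tt ; sym = λ _ → lift tt ; trans = λ _ _ → lift tt }
      ; contains-≈    = λ _ → lift tt
      ; compatible    = λ _ _ → lift tt
      }

    infixr 6 _∨ᶜ_
    infixr 7 _∧ᶜ_

    _∨ᶜ_ : Congruence A ℓ → Congruence A ℓ → Congruence A ℓ
    α ∨ᶜ β = Cg A (λ x y → rel α x y ⊎ rel β x y)

    _∧ᶜ_ : Congruence A ℓ → Congruence A ℓ → Congruence A ℓ
    α ∧ᶜ β = record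
      { rel           = λ x y → rel α x y × rel β x y
      ; isEquivalence = record
        { refl  = α.refl , β.refl
        ; sym   = λ (d , e) → α.sym d , β.sym e
        ; trans = λ (d , e) (d′ , e′) → α.trans d d′ , β.trans e e′
        }
      ; contains-≈    = λ e → Congruence.contains-≈ α e , Congruence.contains-≈ β e
      ; compatible    = λ f e →
          Congruence.compatible α f (proj₁ ∘ e) , Congruence.compatible β f (proj₂ ∘ e)
      }
      where
      module α = IsEquivalence (Congruence.isEquivalence α)
      module β = IsEquivalence (Congruence.isEquivalence β)

    ⋁ : Pred (Congruence A r) p → Congruence A (ℓ ⊔ suc r ⊔ p)
    ⋁ {r = r} S = Cg A (λ x y → Σ (Congruence A r) λ α → α ∈ S × rel α x y)

  Con : Algebra τ ℓ → BoundedLattice (suc ℓ) ℓ ℓ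
  Con {ℓ = ℓ} A = record
    { Carrier          = Congruence A ℓ
    ; _≈_              = _≋_
    ; _≤_              = _⊑_
    ; _∨_              = _∨ᶜ_
    ; _∧_              = _∧ᶜ_
    ; ⊤                = ∇
    ; ⊥                = Δ
    ; isBoundedLattice = record
      { isLattice = record
        { isPartialOrder = record
          { isPreorder = record
            { isEquivalence = record
              { refl  = (λ d → d) , (λ d → d)
              ; sym   = λ (d , e) → e , d
              ; trans = λ (d , e) (d′ , e′) → (λ z → d′ (d z)) , (λ z → e (e′ z))
              }
            ; reflexive = λ e → proj₁ e
            ; trans     = λ d e z → e (d z)
            }
          ; antisym = λ d e → d , e
          }
        ; supremum = λ α β →
            (λ d → base (inj₁ d)) , (λ d → base (inj₂ d)) ,
            λ γ α⊑γ β⊑γ → Cg-least γ [ α⊑γ , β⊑γ ]′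
        ; infimum  = λ α β →
            proj₁ , proj₂ , λ γ γ⊑α γ⊑β d → γ⊑α d , γ⊑β d
        }
      ; maximum = λ _ _ → lift tt
      ; minimum = λ α → Congruence.contains-≈ α
      }
    }

  Compact : (A : Algebra τ ℓ) → Pred (Congruence A ℓ) (suc (suc ℓ))
  Compact {ℓ = ℓ} A α =
    (S : Pred (Congruence A ℓ) (suc ℓ)) → α ⊑ ⋁ S →
    Σ (List (Congruence A ℓ)) λ γs → All S γs × α ⊑ ⋁ (_∈ₗ γs)

  Maximal : (A : Algebra τ ℓ) → Pred (Congruence A ℓ) (suc ℓ)
  Maximal {ℓ = ℓ} A φ =
    ¬ (φ ≋ ∇ {A = A}) × ((ψ : Congruence A ℓ) → φ ⊑ ψ → ¬ (ψ ≋ ∇ {A = A}) → ψ ≋ φ)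

  Rad : (A : Algebra τ ℓ) → Congruence A (suc ℓ)
  Rad A = record
    { rel           = λ x y → ∀ φ → Maximal A φ → rel φ x y
    ; isEquivalence = record
      { refl  = λ φ _ → IsEquivalence.refl (Congruence.isEquivalence φ)
      ; sym   = λ d φ m → IsEquivalence.sym (Congruence.isEquivalence φ) (d φ m)
      ; trans = λ d e φ m → IsEquivalence.trans (Congruence.isEquivalence φ) (d φ m) (e φ m)
      }
    ; contains-≈    = λ e φ _ → Congruence.contains-≈ φ e
    ; compatible    = λ f e φ m → Congruence.compatible φ f (λ i → e i φ m)
    }

  -- The term condition C(α,β;δ).
  Centralizes : {A : Algebra τ ℓ} → Congruence A ℓ → Congruence A ℓ → Congruence A ℓ → Set ℓ
  Centralizes {A = A} α β δ =
    ∀ {m n} (t : Term τ (Fin m ⊎ Fin n))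
    {a a′ : Vector Carrier m} {b b′ : Vector Carrier n} →
    (∀ i → rel α (a i) (a′ i)) → (∀ j → rel β (b j) (b′ j)) →
    rel δ (eval A t [ a  , b ]′) (eval A t [ a  , b′ ]′) →
    rel δ (eval A t [ a′ , b ]′) (eval A t [ a′ , b′ ]′)
    where open Algebra A

  module _ {A : Algebra τ ℓ} (α β : Congruence A ℓ) where
    open Algebra A

    data CommutatorRel : Rel Carrier ℓ where
      ≈⇒     : ∀ {x y} → x ≈ y → CommutatorRel x y
      symm   : ∀ {x y} → CommutatorRel x y → CommutatorRel y x
      transi : ∀ {x y z} → CommutatorRel x y → CommutatorRel y z → CommutatorRel x z
      compat : ∀ f {xs ys : Vector Carrier (arity τ f)} →
               (∀ i → CommutatorRel (xs i) (ys i)) → CommutatorRel (⟦ f ⟧ xs) (⟦ f ⟧ ys)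
      centr  : ∀ {m n} (t : Term τ (Fin m ⊎ Fin n))
               {a a′ : Vector Carrier m} {b b′ : Vector Carrier n} →
               (∀ i → rel α (a i) (a′ i)) → (∀ j → rel β (b j) (b′ j)) →
               CommutatorRel (eval A t [ a  , b ]′) (eval A t [ a  , b′ ]′) →
               CommutatorRel (eval A t [ a′ , b ]′) (eval A t [ a′ , b′ ]′)

    -- The least δ with C(α,β;δ), generated inductively because the
    -- intersection of all such δ would live in a larger universe; see
    -- commutator-centralizes and commutator-least.
    [_,_]ᶜ : Congruence A ℓ
    [_,_]ᶜ = record
      { rel           = CommutatorRel
      ; isEquivalence = record { refl = ≈⇒ refl ; sym = symm ; trans = transi }
      ; contains-≈    = ≈⇒
      ; compatible    = compat
      }

    commutator-centralizes : Centralizes α β [_,_]ᶜ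
    commutator-centralizes = centr

    commutator-least : ∀ δ → Centralizes α β δ → [_,_]ᶜ ⊑ δ
    commutator-least δ C (≈⇒ e)          = Congruence.contains-≈ δ e
    commutator-least δ C (symm d)        =
      IsEquivalence.sym (Congruence.isEquivalence δ) (commutator-least δ C d)
    commutator-least δ C (transi d e)    =
      IsEquivalence.trans (Congruence.isEquivalence δ)
        (commutator-least δ C d) (commutator-least δ C e)
    commutator-least δ C (compat f e)    =
      Congruence.compatible δ f (λ i → commutator-least δ C (e i))
    commutator-least δ C (centr t d e z) = C t d e (commutator-least δ C z)

  _/_ : (A : Algebra τ ℓ) → Congruence A ℓ → Algebra τ ℓ
  A / θ = record
    { setoid   = record { isEquivalence = Congruence.isEquivalence θ }
    ; ⟦_⟧      = ⟦_⟧
    ; ⟦⟧-cong  = Congruence.compatible θ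
    ; nonempty = nonempty
    }
    where open Algebra A

  -- β/θ for β ⊇ θ: as A / θ has the carrier of A, the relation is that of β.
  _/ᶜ_by_ : {A : Algebra τ ℓ} (β θ : Congruence A ℓ) → θ ⊑ β → Congruence (A / θ) ℓ
  β /ᶜ θ by θ⊑β = record
    { rel           = rel β
    ; isEquivalence = Congruence.isEquivalence β
    ; contains-≈    = θ⊑β
    ; compatible    = Congruence.compatible β
    }

  -- p_θ^•(α) = (α ∨ θ)/θ
  p• : {A : Algebra τ ℓ} (θ : Congruence A ℓ) → Congruence A ℓ → Congruence (A / θ) ℓ
  p• θ α = (α ∨ᶜ θ) /ᶜ θ by (λ d → base (inj₂ d))

  -- p_θ lifts Ω′ to Ω, i.e. Ω′ = { p_θ^•(α) : α ∈ Ω }.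
  Lifts : {A : Algebra τ ℓ} (θ : Congruence A ℓ) →
          Pred (Congruence (A / θ) ℓ) p → Pred (Congruence A ℓ) q → Set (suc ℓ ⊔ p ⊔ q)
  Lifts {A = A} θ Ω′ Ω = ∀ β → β ∈ Ω′ ⇔ ∃ λ α → α ∈ Ω × β ≋ p• θ α

-- A class of algebras closed under H, S and P.
record Variety (τ : Signature) (ℓ v : Level) : Set (suc ℓ ⊔ suc v) where
  field
    member   : Pred (Algebra τ ℓ) v
    H-closed : ∀ {A B} (h : Hom A B) → IsSurjective h → A ∈ member → B ∈ member
    S-closed : ∀ {A} (S : Subalgebra A) → A ∈ member → ⌞ S ⌟ ∈ member
    P-closed : ∀ {I : Set ℓ} (A : I → Algebra τ ℓ) → (∀ i → A i ∈ member) → Π A ∈ member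

module _ {τ : Signature} (𝒱 : Variety τ ℓ v) where
  open Variety 𝒱

  CongruenceModular : Set (suc ℓ ⊔ v)
  CongruenceModular = ∀ B → B ∈ member → Modular (BoundedLattice.lattice (Con B))

  Semidegenerate : Set (suc ℓ ⊔ v)
  Semidegenerate = ∀ B → B ∈ member → ¬ Trivial B → ¬ (Σ (Subalgebra B) λ S → Trivial ⌞ S ⌟)

  CompactClosedUnderCommutator : Set (suc (suc ℓ) ⊔ v)
  CompactClosedUnderCommutator =
    ∀ B → B ∈ member → ∀ α β → Compact B α → Compact B β → Compact B [ α , β ]ᶜ

{-# OPTIONS --safe #-}

-- The idea is that Con A satisfies enough distributivity for the elements of
-- B(Con A) to be determined modulo the radical.
--
-- Let α₁ ∨ α₂ = ∇, let β be a congruence and δ = (α₁ ∧ β) ∨ (α₂ ∧ β).  On the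
-- subalgebra β of A × A consider the largest congruence M saturating δ ⊆ β.  By
-- modularity, x αᵢ y implies (x , x) M (y , y); as α₁ ∨ α₂ = ∇, the diagonal lies
-- in one M-class, which is a one-element subalgebra of β / M.  By
-- semidegeneracy β / M is trivial, so δ = β.
--
-- Semidegeneracy and the finiteness of the signature also make every proper
-- congruence lie below a maximal one: ∇ is the only congruence containing all
-- the pairs (f(a,…,a) , a) for a fixed a.  Hence γ ∨ θ = ∇ forces γ = ∇ if
-- θ ⊆ Rad A.  If e, f are complemented, e′ is a complement of e and
-- e ∨ θ = f ∨ θ, this gives f ∨ e′ = ∇, so that e = (f ∧ e) ∨ (e′ ∧ e) ⊆ f.
-- Likewise e ∧ f ⊆ θ gives f′ ∨ e′ = ∇ for a complement f′ of f, so e ⊆ f′.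

module Submission where

open import Defs
open import Level using (Level; _⊔_; Lift; lift; lower) renaming (suc to lsuc)
open import Axiom.ExcludedMiddle using (ExcludedMiddle)
open import Data.Bool.Base using (Bool; true; false)
open import Data.Empty using (⊥-elim)
open import Data.Fin.Base using (Fin; zero; suc; _↑ˡ_; _↑ʳ_)
open import Data.Nat.Base using (zero; suc; _+_)
open import Data.Product.Base using (∃; Σ; _×_; _,_; proj₁; proj₂)
open import Data.Sum.Base using (_⊎_; inj₁; inj₂; [_,_]′)
open import Data.Unit.Base using (tt)
open import Data.Vec.Functional using (Vector; _∷_; _++_)
open import Data.Vec.Functional.Properties using (lookup-++ˡ; lookup-++ʳ)
open import Function.Base using (_∘_; id; _on_)
open import Function.Bundles using (_⇔_; mk⇔; Equivalence)
open import Relation.Binary.Bundles using (Poset)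
open import Relation.Binary.Core using (Rel)
open import Relation.Binary.Definitions using (_Respects_)
open import Relation.Binary.Structures using (IsEquivalence)
open import Relation.Nullary.Decidable using (True; toWitness; fromWitness; yes; no; decidable-stable)
open import Relation.Nullary.Negation using (¬_)
open import Relation.Unary using (Pred; _∈_; _⊆_; _≐_)

open Signature using (arity)
open Congruence using (rel; contains-≈; compatible)

private
  variable
    c ℓ ℓ₁ ℓ₂ p r v : Level
    τ : Signature

-- Terms

subst : {X Y : Set} → (X → Term τ Y) → Term τ X → Term τ Y
subst σ (var x)    = σ x
subst σ (app f ts) = app f (λ i → subst σ (ts i))

module _ (A : Algebra τ ℓ) where
  open Algebra A

  eval-subst : {X Y : Set} (σ : X → Term τ Y) (t : Term τ X) (ρ : Y → Carrier) →
               eval A (subst σ t) ρ ≈ eval A t (λ x → eval A (σ x) ρ)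
  eval-subst σ (var x)    ρ = refl
  eval-subst σ (app f ts) ρ = ⟦⟧-cong f (λ i → eval-subst σ (ts i) ρ)

  eval-compatible : (γ : Congruence A r) {X : Set} (t : Term τ X) {ρ ρ′ : X → Carrier} →
                    (∀ x → rel γ (ρ x) (ρ′ x)) → rel γ (eval A t ρ) (eval A t ρ′)
  eval-compatible γ (var x)    e = e x
  eval-compatible γ (app f ts) e = compatible γ f (λ i → eval-compatible γ (ts i) e)

  eval-subst-≈ : {X Y : Set} (σ : X → Term τ Y) (t : Term τ X)
                 {ρ : Y → Carrier} {ρ′ : X → Carrier} →
                 (∀ x → eval A (σ x) ρ ≈ ρ′ x) → eval A (subst σ t) ρ ≈ eval A t ρ′
  eval-subst-≈ σ t e = trans (eval-subst σ t _) (eval-compatible Δ t e)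

-- The largest congruence saturating a subset

module Syntactic (A : Algebra τ ℓ) (P : Pred (Algebra.Carrier A) ℓ)
                 (P-resp : P Respects (Algebra._≈_ A)) where
  open Algebra A

  infix 4 _~_
  -- The syntactic congruence of `P`. A unary polynomial is encoded as a term whose variable `zero`
  -- is the argument and whose other variables hold parameters.
  _~_ : Rel Carrier ℓ
  x ~ y = ∀ {n} (t : Term τ (Fin (suc n))) (ρ : Vector Carrier n) →
          P (eval A t (x ∷ ρ)) ⇔ P (eval A t (y ∷ ρ))

  ~-sym : ∀ {x y} → x ~ y → y ~ x
  ~-sym x~y t ρ = mk⇔ (Equivalence.from (x~y t ρ)) (Equivalence.to (x~y t ρ))

  ~-trans : ∀ {x y z} → x ~ y → y ~ z → x ~ z
  ~-trans x~y y~z t ρ = mk⇔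
    (Equivalence.to (y~z t ρ) ∘ Equivalence.to (x~y t ρ))
    (Equivalence.from (x~y t ρ) ∘ Equivalence.from (y~z t ρ))

  ≈⇒~ : ∀ {x y} → x ≈ y → x ~ y
  ≈⇒~ {x} {y} x≈y t ρ = mk⇔ (P-resp e) (P-resp (sym e))
    where
    e : eval A t (x ∷ ρ) ≈ eval A t (y ∷ ρ)
    e = eval-compatible A Δ t λ { zero → x≈y ; (suc _) → refl }

  P-resp-~ : P Respects _~_
  P-resp-~ x~y = Equivalence.to (x~y {0} (var zero) λ ())

  -- `_~_` changes one variable at a time, so the entries are exchanged by induction on `k`; an
  -- entry already exchanged joins the parameters.
  replace : ∀ k {n} (t : Term τ (Fin k ⊎ Fin n)) {xs ys : Vector Carrier k}
            (ρ : Vector Carrier n) → (∀ i → xs i ~ ys i) →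
            P (eval A t [ xs , ρ ]′) → P (eval A t [ ys , ρ ]′)
  replace zero t ρ xs~ys =
    P-resp (eval-compatible A Δ t λ { (inj₁ ()) ; (inj₂ _) → refl })
  replace (suc k) {n} t {xs} {ys} ρ xs~ys =
      -- Read from the bottom: `first` makes the head the argument of a polynomial, and `last` then
      -- turns the new head into a parameter.
      P-resp (trans (last-≈ (ys ∘ suc)) (∷-η ys))
    ∘ replace k (subst last t) (ys zero ∷ ρ) (xs~ys ∘ suc)
    ∘ P-resp (trans (first-≈ (ys zero)) (sym (last-≈ (xs ∘ suc))))
    ∘ Equivalence.to (xs~ys zero (subst first t) ((xs ∘ suc) ++ ρ))
    ∘ P-resp (sym (trans (first-≈ (xs zero)) (∷-η xs)))
    where
    first : Fin (suc k) ⊎ Fin n → Term τ (Fin (suc (k + n)))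
    first (inj₁ zero)    = var zero
    first (inj₁ (suc i)) = var (suc (i ↑ˡ n))
    first (inj₂ j)       = var (suc (k ↑ʳ j))

    last : Fin (suc k) ⊎ Fin n → Term τ (Fin k ⊎ Fin (suc n))
    last (inj₁ zero)    = var (inj₂ zero)
    last (inj₁ (suc i)) = var (inj₁ i)
    last (inj₂ j)       = var (inj₂ (suc j))

    ∷-η : ∀ zs → eval A t [ zs zero ∷ (zs ∘ suc) , ρ ]′ ≈ eval A t [ zs , ρ ]′
    ∷-η zs = eval-compatible A Δ t λ where
      (inj₁ zero)    → refl
      (inj₁ (suc _)) → refl
      (inj₂ _)       → refl

    first-≈ : ∀ x → eval A (subst first t) (x ∷ ((xs ∘ suc) ++ ρ)) ≈
                    eval A t [ x ∷ (xs ∘ suc) , ρ ]′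
    first-≈ x = eval-subst-≈ A first t λ where
      (inj₁ zero)    → refl
      (inj₁ (suc i)) → reflexive (lookup-++ˡ (xs ∘ suc) ρ i)
      (inj₂ j)       → reflexive (lookup-++ʳ (xs ∘ suc) ρ j)

    last-≈ : ∀ {y} zs → eval A (subst last t) [ zs , y ∷ ρ ]′ ≈ eval A t [ y ∷ zs , ρ ]′
    last-≈ zs = eval-subst-≈ A last t λ where
      (inj₁ zero)    → refl
      (inj₁ (suc _)) → refl
      (inj₂ _)       → refl

  ~-compatible : ∀ f {xs ys : Vector Carrier (arity τ f)} →
                 (∀ i → xs i ~ ys i) → ⟦ f ⟧ xs ~ ⟦ f ⟧ ys
  ~-compatible f xs~ys t ρ = mk⇔ (step xs~ys) (step (λ i → ~-sym (xs~ys i)))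
    where
    σ : Fin (suc _) → Term τ (Fin (arity τ f) ⊎ Fin _)
    σ zero    = app f (var ∘ inj₁)
    σ (suc j) = var (inj₂ j)

    unfold : ∀ zs → eval A (subst σ t) [ zs , ρ ]′ ≈ eval A t (⟦ f ⟧ zs ∷ ρ)
    unfold zs = eval-subst-≈ A σ t λ { zero → refl ; (suc _) → refl }

    step : ∀ {zs ws} → (∀ i → zs i ~ ws i) →
           P (eval A t (⟦ f ⟧ zs ∷ ρ)) → P (eval A t (⟦ f ⟧ ws ∷ ρ))
    step {zs} {ws} zs~ws =
      P-resp (unfold ws) ∘ replace _ (subst σ t) ρ zs~ws ∘ P-resp (sym (unfold zs))

  congruence : Congruence A ℓ
  congruence = record
    { rel           = _~_
    ; isEquivalence = record { refl = ≈⇒~ refl ; sym = ~-sym ; trans = ~-trans }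
    ; contains-≈    = ≈⇒~
    ; compatible    = ~-compatible
    }

-- Chains

module _ (P : Poset c ℓ₁ ℓ₂) where
  open Poset P

  -- The bound is itself a member of `C`. This is how finiteness of the arities and of the set of
  -- operations enters.
  chain-bounds-vector : {C : Pred Carrier p} → IsChain P C → ∃ C →
                        ∀ {n} (xs : Vector Carrier n) → (∀ i → xs i ∈ C) →
                        ∃ λ u → u ∈ C × ∀ i → xs i ≤ u
  chain-bounds-vector ch (x , x∈C) {zero}  xs xs∈C = x , x∈C , λ ()
  chain-bounds-vector ch ne        {suc n} xs xs∈C
    with u , u∈C , xs≤u ← chain-bounds-vector ch ne (xs ∘ suc) (xs∈C ∘ suc)
    with ch (xs∈C zero) u∈C
  ... | inj₁ x≤u = u , u∈C , λ { zero → x≤u ; (suc i) → xs≤u i }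
  ... | inj₂ u≤x = xs zero , xs∈C zero , λ { zero → refl ; (suc i) → trans (xs≤u i) u≤x }

-- Proper congruences in a semidegenerate variety

Proper : {A : Algebra τ ℓ} → Pred (Congruence A r) (ℓ ⊔ r)
Proper {A = A} φ = ¬ (φ ≋ ∇ {A = A})

module _ (em : ∀ {l : Level} → ExcludedMiddle l) {τ : Signature} (𝒱 : Variety τ ℓ v)
         (semidegenerate : Semidegenerate 𝒱) where
  private
    module 𝒱 = Variety 𝒱

  quotient-member : {A : Algebra τ ℓ} → A ∈ 𝒱.member → (θ : Congruence A ℓ) →
                    (A / θ) ∈ 𝒱.member
  quotient-member {A} A∈𝒱 θ = 𝒱.H-closed
    (record { to = id ; cong = contains-≈ θ ; homo = λ _ _ → IsEquivalence.refl (Congruence.isEquivalence θ) })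
    (λ y → y , IsEquivalence.refl (Congruence.isEquivalence θ))
    A∈𝒱

  idempotent⇒trivial : {A : Algebra τ ℓ} → A ∈ 𝒱.member → let open Algebra A in
                       (a : Carrier) → (∀ f → ⟦ f ⟧ (λ _ → a) ≈ a) → Trivial A
  idempotent⇒trivial {A} A∈𝒱 a idem = decidable-stable em λ nontrivial →
    semidegenerate A A∈𝒱 nontrivial
      ( record
        { member    = _≈ a
        ; respects  = λ x≈y x≈a → trans (sym x≈y) x≈a
        ; closed    = λ f xs xs≈a → trans (⟦⟧-cong f xs≈a) (idem f)
        ; inhabited = a , refl
        }
      , λ (x , x≈a) (y , y≈a) → trans x≈a (sym y≈a))
    where open Algebra A

  -- The class of `a` is a one-element subalgebra of `A / φ`. Being `∇` is thus decided by one pair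
  -- per operation symbol.
  collapses-idempotent⇒∇ : {A : Algebra τ ℓ} → A ∈ 𝒱.member → let open Algebra A in
                           (φ : Congruence A ℓ) (a : Carrier) →
                           (∀ f → rel φ (⟦ f ⟧ (λ _ → a)) a) → ∇ {A = A} ⊑ φ
  collapses-idempotent⇒∇ A∈𝒱 φ a idem _ =
    idempotent⇒trivial (quotient-member A∈𝒱 φ) a idem _ _

  -- Maximal congruences

  module _ {A : Algebra τ ℓ} (A∈𝒱 : A ∈ 𝒱.member) (γ : Congruence A ℓ) where
    open Algebra A

    private
      ProperAbove : Set (lsuc ℓ)
      ProperAbove = Σ (Congruence A ℓ) λ φ → γ ⊑ φ × Proper φ

      properAbove : Poset (lsuc ℓ) ℓ ℓ
      properAbove = record
        { Carrier        = ProperAbove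
        ; _≈_            = λ φ ψ → proj₁ φ ≋ proj₁ ψ
        ; _≤_            = λ φ ψ → proj₁ φ ⊑ proj₁ ψ
        ; isPartialOrder = record
          { isPreorder = record
            { isEquivalence = record
              { refl  = id , id
              ; sym   = λ (d , e) → e , d
              ; trans = λ (d , e) (d′ , e′) → (d′ ∘ d) , (e ∘ e′)
              }
            ; reflexive = λ e → proj₁ e
            ; trans     = λ d e → e ∘ d
            }
          ; antisym = λ d e → d , e
          }
        }

      module _ (C : Pred ProperAbove (lsuc ℓ)) (chain : IsChain properAbove C) (ne : ∃ C) where

        Related : Carrier → Carrier → Set (lsuc ℓ)
        Related x y = ∃ λ φ → φ ∈ C × rel (proj₁ φ) x y

        relates-vectors : ∀ {n} {xs ys : Vector Carrier n} → (∀ i → Related (xs i) (ys i)) →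
                          ∃ λ φ → φ ∈ C × ∀ i → rel (proj₁ φ) (xs i) (ys i)
        relates-vectors R
          with u , u∈C , ≤u ← chain-bounds-vector properAbove chain ne (proj₁ ∘ R) (proj₁ ∘ proj₂ ∘ R)
          = u , u∈C , λ i → ≤u i (proj₂ (proj₂ (R i)))

        -- Related lives one universe too high; excluded middle resizes it.
        Union : Rel Carrier ℓ
        Union x y = Lift ℓ (True (em {P = Related x y}))

        into : ∀ {x y} → Related x y → Union x y
        into R = lift (fromWitness R)

        out : ∀ {x y} → Union x y → Related x y
        out U = toWitness (lower U)

        union-trans : ∀ {x y z} → Related x y → Related y z → Related x z
        union-trans (φ , φ∈C , d) (ψ , ψ∈C , e) with chain φ∈C ψ∈C
        ... | inj₁ φ≤ψ = ψ , ψ∈C , IsEquivalence.trans (Congruence.isEquivalence (proj₁ ψ)) (φ≤ψ d) e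
        ... | inj₂ ψ≤φ = φ , φ∈C , IsEquivalence.trans (Congruence.isEquivalence (proj₁ φ)) d (ψ≤φ e)

        union : Congruence A ℓ
        union = record
          { rel           = Union
          ; isEquivalence = record
            { refl  = ≈⇒Union refl
            ; sym   = λ U → let φ , φ∈C , d = out U in
                      into (φ , φ∈C , IsEquivalence.sym (Congruence.isEquivalence (proj₁ φ)) d)
            ; trans = λ U V → into (union-trans (out U) (out V))
            }
          ; contains-≈    = ≈⇒Union
          ; compatible    = λ f Us → let φ , φ∈C , d = relates-vectors (out ∘ Us) in
                            into (φ , φ∈C , compatible (proj₁ φ) f d)
          }
          where
          ≈⇒Union : ∀ {x y} → x ≈ y → Union x y
          ≈⇒Union e = let φ , φ∈C = ne in into (φ , φ∈C , contains-≈ (proj₁ φ) e)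

        -- If the union were `∇`, one member of the chain would contain the finitely many pairs that
        -- force a congruence to be `∇`.
        union-proper : Proper union
        union-proper (_ , ∇⊑union)
          with (φ , _ , φ-proper) , _ , d ←
            relates-vectors {xs = λ f → ⟦ f ⟧ (λ _ → nonempty)} {ys = λ _ → nonempty}
              (λ _ → out (∇⊑union (lift tt)))
          = φ-proper ((λ _ → lift tt) , collapses-idempotent⇒∇ A∈𝒱 φ nonempty d)

        union-bound : ∃ (UpperBound properAbove C)
        union-bound =
          ( union
          , (λ d → let (φ , γ⊑φ , φ-proper) , φ∈C = ne in into (_ , φ∈C , γ⊑φ d))
          , union-proper )
          , λ φ∈C d → into (_ , φ∈C , d)

      bound : Proper γ → (C : Pred ProperAbove (lsuc ℓ)) → IsChain properAbove C →
              ∃ (UpperBound properAbove C)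
      bound γ-proper C chain with em {P = ∃ C}
      ... | yes ne = union-bound C chain ne
      -- The empty chain is bounded by `γ` itself.
      ... | no ¬ne = (γ , id , γ-proper) , λ {φ} φ∈C → ⊥-elim (¬ne (φ , φ∈C))

    maximal-above : ZornsLemma (lsuc ℓ) ℓ ℓ → Proper γ →
                    ∃ λ φ → Maximal A φ × γ ⊑ φ
    maximal-above zorn γ-proper
      with (φ , γ⊑φ , φ-proper) , φ-max ← zorn properAbove (bound γ-proper)
      -- Any proper `ψ` above `φ` is also above `γ`, so maximality in the poset is maximality in
      -- `Con A`.
      = φ , (φ-proper , λ ψ φ⊑ψ ψ-proper → φ-max {ψ , φ⊑ψ ∘ γ⊑φ , ψ-proper} φ⊑ψ) , γ⊑φ

    -- A maximal congruence above a proper `γ` contains `θ` too, hence all of `γ ∨ᶜ θ`.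
    radical-superfluous : ZornsLemma (lsuc ℓ) ℓ ℓ → (θ : Congruence A ℓ) → θ ⊑ Rad A →
                          ∇ ⊑ γ ∨ᶜ θ → ∇ ⊑ γ
    radical-superfluous zorn θ θ⊑Rad ∇⊑γ∨θ with em {P = γ ≋ ∇ {A = A}}
    ... | yes γ≋∇     = proj₂ γ≋∇
    ... | no γ-proper with φ , φ-max , γ⊑φ ← maximal-above zorn γ-proper =
      ⊥-elim (proj₁ φ-max
        ( (λ _ → lift tt)
        , λ d → Cg-least φ [ γ⊑φ , (λ e → θ⊑Rad e φ φ-max) ]′ (∇⊑γ∨θ d)))

  -- Distributivity

  module _ (modular : CongruenceModular 𝒱) {A : Algebra τ ℓ} (A∈𝒱 : A ∈ 𝒱.member) where
    private
      module A = Algebra A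
      A×A : Algebra τ ℓ
      A×A = Π {I = Lift ℓ Bool} (λ _ → A)

    asSubalgebra : Congruence A ℓ → Subalgebra A×A
    asSubalgebra β = record
      { member    = λ x → rel β (x (lift false)) (x (lift true))
      ; respects  = λ e d → β.trans (contains-≈ β (A.sym (e _))) (β.trans d (contains-≈ β (e _)))
      ; closed    = λ f xs d → compatible β f d
      ; inhabited = (λ _ → A.nonempty) , β.refl
      }
      where module β = IsEquivalence (Congruence.isEquivalence β)

    module _ (β δ : Congruence A ℓ) (δ⊑β : δ ⊑ β) where
      private
        module β = IsEquivalence (Congruence.isEquivalence β)
        module δ = IsEquivalence (Congruence.isEquivalence δ)
        B : Algebra τ ℓ
        B = ⌞ asSubalgebra β ⌟
        module B = Algebra B

        B∈𝒱 : B ∈ 𝒱.member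
        B∈𝒱 = 𝒱.S-closed (asSubalgebra β) (𝒱.P-closed _ (λ _ → A∈𝒱))

        In-δ : Pred B.Carrier ℓ
        In-δ (x , _) = rel δ (x (lift false)) (x (lift true))

        open Syntactic B In-δ
          (λ e d → δ.trans (contains-≈ δ (A.sym (e _))) (δ.trans d (contains-≈ δ (e _))))

        diagonal : A.Carrier → B.Carrier
        diagonal x = (λ _ → x) , β.refl

      -- The pullback of `congruence` along the diagonal. Unfolded, it is the term condition: the
      -- largest `α` with `Centralizes α β δ`.
      centralizer : Congruence A ℓ
      centralizer = record
        { rel           = _~_ on diagonal
        ; isEquivalence = record { refl = ≈⇒~ (λ _ → A.refl) ; sym = ~-sym ; trans = ~-trans }
        ; contains-≈    = λ e → ≈⇒~ (λ _ → e)
        ; compatible    = λ f d → ~-trans (≈⇒~ λ _ → A.refl) (~-trans (~-compatible f d) (≈⇒~ λ _ → A.refl))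
        }

      meet-below⇒⊑-centralizer : (α : Congruence A ℓ) → α ∧ᶜ β ⊑ δ → α ⊑ centralizer
      meet-below⇒⊑-centralizer α α∧β⊑δ d t ρ = mk⇔ (step d) (step (α.sym d))
        where
        module α = IsEquivalence (Congruence.isEquivalence α)

        coordinatewise : Congruence B ℓ
        coordinatewise = record
          { rel           = λ x y → ∀ i → rel α (proj₁ x i) (proj₁ y i)
          ; isEquivalence = record
            { refl  = λ _ → α.refl
            ; sym   = λ e i → α.sym (e i)
            ; trans = λ e e′ i → α.trans (e i) (e′ i)
            }
          ; contains-≈    = λ e i → contains-≈ α (e i)
          ; compatible    = λ f e i → compatible α f (λ j → e j i)
          }

        step : ∀ {x y} → rel α x y →
               In-δ (eval B t (diagonal x ∷ ρ)) → In-δ (eval B t (diagonal y ∷ ρ))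
        -- The value at `y` is a pair of `β`, and its coordinates are linked by `α`, `δ`, `α`
        -- through the value at `x`. Modularity gives `(δ ∨ α) ∧ β = δ ∨ (α ∧ β)`, which is below
        -- `δ`.
        step {x} {y} d z = Cg-least δ [ id , α∧β⊑δ ]′
          (proj₂ (modular A A∈𝒱 δ α β δ⊑β)
            ( transi (base (inj₂ (α.sym (e _)))) (transi (base (inj₁ z)) (base (inj₂ (e _))))
            , proj₂ (eval B t (diagonal y ∷ ρ))))
          where
          e : ∀ i → rel α (proj₁ (eval B t (diagonal x ∷ ρ)) i) (proj₁ (eval B t (diagonal y ∷ ρ)) i)
          e = eval-compatible B coordinatewise t
                λ { zero _ → d ; (suc _) _ → α.refl }

      -- All diagonal pairs are identified, so their class is idempotent and `congruence` is `∇`.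
      -- Every pair of `β` is then identified with a diagonal one, which lies in `δ`.
      ∇-centralizes⇒⊑ : ∇ {A = A} ⊑ centralizer → β ⊑ δ
      ∇-centralizes⇒⊑ ∇⊑centralizer {x} {y} x-β-y =
        P-resp-~ {diagonal A.nonempty} {pair}
          (collapses-idempotent⇒∇ B∈𝒱 congruence (diagonal A.nonempty)
            (λ f → ~-trans (≈⇒~ λ _ → A.refl) (∇⊑centralizer (lift tt))) (lift tt))
          δ.refl
        where
        pair : B.Carrier
        pair = (λ { (lift false) → x ; (lift true) → y }) , x-β-y

    ∧-distribʳ-cover : (α₁ α₂ β : Congruence A ℓ) → ∇ ⊑ α₁ ∨ᶜ α₂ →
                       β ⊑ (α₁ ∧ᶜ β) ∨ᶜ (α₂ ∧ᶜ β)
    ∧-distribʳ-cover α₁ α₂ β cover = ∇-centralizes⇒⊑ β δ δ⊑β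
      λ d → Cg-least (centralizer β δ δ⊑β)
              [ meet-below⇒⊑-centralizer β δ δ⊑β α₁ (base ∘ inj₁)
              , meet-below⇒⊑-centralizer β δ δ⊑β α₂ (base ∘ inj₂) ]′
              (cover d)
      where
      δ : Congruence A ℓ
      δ = (α₁ ∧ᶜ β) ∨ᶜ (α₂ ∧ᶜ β)

      δ⊑β : δ ⊑ β
      δ⊑β = Cg-least β [ proj₂ , proj₂ ]′

    -- Distributing `e` over the cover leaves `f ∧ e` joined with `e′ ∧ e`, and the latter is `Δ`.
    disjoint-cover⇒⊑ : (e e′ f : Congruence A ℓ) → e ∧ᶜ e′ ⊑ Δ {A = A} →
                       ∇ ⊑ f ∨ᶜ e′ → e ⊑ f
    disjoint-cover⇒⊑ e e′ f disjoint cover d =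
      Cg-least f [ proj₁ , (λ (d₁ , d₂) → contains-≈ f (disjoint (d₂ , d₁))) ]′
        (∧-distribʳ-cover f e′ e cover d)

    -- Complemented congruences modulo a congruence below the radical

    module _ (zorn : ZornsLemma (lsuc ℓ) ℓ ℓ) (θ : Congruence A ℓ) (θ⊑Rad : θ ⊑ Rad A) where

      p•-reflects-⊑ : (e f : Congruence A ℓ) → e ∈ Complemented (Con A) →
                      p• θ e ⊑ p• θ f → e ⊑ f
      p•-reflects-⊑ e f (e′ , e∨e′≋∇ , e∧e′≋Δ) pe⊑pf =
        disjoint-cover⇒⊑ e e′ f (proj₁ e∧e′≋Δ)
          (radical-superfluous A∈𝒱 (f ∨ᶜ e′) zorn θ θ⊑Rad
            (Cg-least ((f ∨ᶜ e′) ∨ᶜ θ)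
              [ Cg-least ((f ∨ᶜ e′) ∨ᶜ θ) [ base ∘ inj₁ ∘ base ∘ inj₁ , base ∘ inj₂ ]′
                  ∘ pe⊑pf ∘ base ∘ inj₁
              , base ∘ inj₁ ∘ base ∘ inj₂ ]′
            ∘ proj₂ e∨e′≋∇))

      p•-injective : (e f : Congruence A ℓ) → e ∈ Complemented (Con A) → f ∈ Complemented (Con A) →
                     p• θ e ≋ p• θ f → e ≋ f
      p•-injective e f e-comp f-comp (pe⊑pf , pf⊑pe) =
        p•-reflects-⊑ e f e-comp pe⊑pf , p•-reflects-⊑ f e f-comp pf⊑pe

      -- It suffices that `e` is below `f′`. Distributing `f` over `e ∨ e′` puts `f` below `e′ ∨ θ`,
      -- so `f′ ∨ e′ ∨ θ = ∇`.
      p•-reflects-disjointness : (e f : Congruence A ℓ) →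
        e ∈ Complemented (Con A) → f ∈ Complemented (Con A) →
        p• θ e ∧ᶜ p• θ f ⊑ Δ {A = A / θ} → e ∧ᶜ f ⊑ Δ {A = A}
      p•-reflects-disjointness e f (e′ , e∨e′≋∇ , e∧e′≋Δ) (f′ , f∨f′≋∇ , f∧f′≋Δ) disjoint (d₁ , d₂) =
        proj₁ f∧f′≋Δ (d₂ , e⊑f′ d₁)
        where
        γ : Congruence A ℓ
        γ = f′ ∨ᶜ e′

        e∧f⊑γ∨θ : e ∧ᶜ f ⊑ γ ∨ᶜ θ
        e∧f⊑γ∨θ (d₁ , d₂) = base (inj₂ (disjoint (base (inj₁ d₁) , base (inj₁ d₂))))

        f⊑γ∨θ : f ⊑ γ ∨ᶜ θ
        f⊑γ∨θ = Cg-least (γ ∨ᶜ θ) [ e∧f⊑γ∨θ , base ∘ inj₁ ∘ base ∘ inj₂ ∘ proj₁ ]′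
                  ∘ ∧-distribʳ-cover e e′ f (proj₂ e∨e′≋∇)

        e⊑f′ : e ⊑ f′
        e⊑f′ = disjoint-cover⇒⊑ e e′ f′ (proj₁ e∧e′≋Δ)
          (radical-superfluous A∈𝒱 γ zorn θ θ⊑Rad
            (Cg-least (γ ∨ᶜ θ) [ f⊑γ∨θ , base ∘ inj₁ ∘ base ∘ inj₁ ]′ ∘ proj₂ f∨f′≋∇))

      -- The image of `φ` is also the image of some `ψ` in `Ψ`; injectivity gives `φ ≋ ψ`, and `Ψ`
      -- respects `≋`.
      lifts-⊆ : (Ω′ : Pred (Congruence (A / θ) ℓ) p) (Φ Ψ : Subset (Con A) p) →
                Subset.member Φ ⊆ Complemented (Con A) → Subset.member Ψ ⊆ Complemented (Con A) →
                Lifts θ Ω′ (Subset.member Φ) → Lifts θ Ω′ (Subset.member Ψ) →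
                Subset.member Φ ⊆ Subset.member Ψ
      lifts-⊆ Ω′ Φ Ψ Φ-comp Ψ-comp Φ-lifts Ψ-lifts {φ} φ∈Φ
        with ψ , ψ∈Ψ , pφ≋pψ ← Equivalence.to (Ψ-lifts (p• θ φ))
               (Equivalence.from (Φ-lifts (p• θ φ)) (φ , φ∈Φ , id , id))
        with φ⊑ψ , ψ⊑φ ← p•-injective φ ψ (Φ-comp φ∈Φ) (Ψ-comp ψ∈Ψ) pφ≋pψ
        = Subset.respects Ψ (ψ⊑φ , φ⊑ψ) ψ∈Ψ

theorem7p3 : ∀ {ℓ v p : Level} →
    (∀ {l : Level} → ExcludedMiddle l) →
    (∀ {c l₁ l₂ : Level} → ZornsLemma c l₁ l₂) →
    (τ : Signature) (𝒱 : Variety τ ℓ v) →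
    CongruenceModular 𝒱 → Semidegenerate 𝒱 → CompactClosedUnderCommutator 𝒱 →
    (A : Algebra τ ℓ) → A ∈ Variety.member 𝒱 →
    (θ : Congruence A ℓ) → θ ⊑ Rad A →
    (Ω′ : Subset (Con (A / θ)) p) →
    Subset.member Ω′ ⊆ Complemented (Con (A / θ)) →
    Orthogonal (Con (A / θ)) (Subset.member Ω′) →
    (Ω : Subset (Con A) p) →
    Subset.member Ω ⊆ Complemented (Con A) →
    Lifts θ (Subset.member Ω′) (Subset.member Ω) →
    ((Ψ : Subset (Con A) p) →
    Subset.member Ψ ⊆ Complemented (Con A) →
    Lifts θ (Subset.member Ω′) (Subset.member Ψ) →
    Subset.member Ψ ≐ Subset.member Ω)
    × Orthogonal (Con A) (Subset.member Ω)
theorem7p3 em zorn τ 𝒱 modular semidegenerate _ A A∈𝒱 θ θ⊑Rad Ω′ _ Ω′-orth Ω Ω-comp Ω-lifts =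
    (λ Ψ Ψ-comp Ψ-lifts →
        lifts-⊆ em 𝒱 semidegenerate modular A∈𝒱 zorn θ θ⊑Rad (Subset.member Ω′) Ψ Ω Ψ-comp Ω-comp Ψ-lifts Ω-lifts
      , lifts-⊆ em 𝒱 semidegenerate modular A∈𝒱 zorn θ θ⊑Rad (Subset.member Ω′) Ω Ψ Ω-comp Ψ-comp Ω-lifts Ψ-lifts)
  , λ {e} {f} e∈Ω f∈Ω e≉f →
        p•-reflects-disjointness em 𝒱 semidegenerate modular A∈𝒱 zorn θ θ⊑Rad e f (Ω-comp e∈Ω) (Ω-comp f∈Ω)
          -- By injectivity, distinct members of `Ω` have distinct images, to which orthogonality of
          -- `Ω′` applies.
          (proj₁ (Ω′-orth (image e∈Ω) (image f∈Ω)
            (e≉f ∘ p•-injective em 𝒱 semidegenerate modular A∈𝒱 zorn θ θ⊑Rad e f (Ω-comp e∈Ω) (Ω-comp f∈Ω))))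
      , contains-≈ (e ∧ᶜ f)
  where
  image : ∀ {e} → e ∈ Subset.member Ω → p• θ e ∈ Subset.member Ω′
  image {e} e∈Ω = Equivalence.from (Ω-lifts (p• θ e)) (e , e∈Ω , id , id)
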